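{- Let $k\geq 1$ and $n\geq 0$. The Munarini graph $M_{n,k}$ is isomorphic to $\Gamma_{n,k}^\star$. In particular, if $n\geq 1$, then $M_{n,k}$ is isomorphic to a subgraph of the Fibonacci cube $\Gamma_{kn-1}$.
   Context: For integers $k\geq 1$, $n\geq 0$, a $k$-generalized Pell string of length $n$ is a word of length $n$ over the alphabet $\{0,1,\ldots,k\}$ in which every maximal run of the character $k$ has even length (equivalently, a concatenation of letters from $\{0,1,\ldots,k-1,kk\}$). Let $\mathcal{F}_{n,k}$ be the set of these strings (for $n=0$ it contains only the empty string). The Munarini graph $M_{n,k}$ is the simple graph with vertex set $\mathcal{F}_{n,k}$ in which two vertices are adjacent if one of them can be obtained from the other either by replacing one occurrence of $0$ with some $i\in\{1,\ldots,k-1\}$, or by replacing one substring $00$ (two consecutive positions) with $kk$ (both replacements may be read in either direction, and both strings must be in $\mathcal{F}_{n,k}$). The Fibonacci cube $\Gamma_m$ is the subgraph of the hypercube $Q_m$ (vertex set $\{0,1\}^m$, two strings adjacent iff they differ in exactly one coordinate) induced by the binary strings of length $m$ with no two consecutive $1$s; $\Gamma_0=K_1$. Let $A_0=0^k$ and $A_i=0^{i-1}10^{k-i}$ for $i\in\{1,\ldots,k\}$ (binary strings of length $k$). A Munarini string is a binary string that is a concatenation of zero or more strings from $\{A_0,A_1,\ldots,A_{k-1},A_kA_0\}$. Let $\mathcal{F}_{n,k}^\star$ be the set of Munarini strings of length $kn$ (they have no two consecutive $1$s), and let $\Gamma_{n,k}^\star$ be the subgraph of $\Gamma_{kn}$ induced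 by $\mathcal{F}_{n,k}^\star$. -}

module Defs where

open import Data.Digit using (Bit; 0b; 1b)
open import Data.Fin.Base using (Fin; zero; toℕ; fromℕ)
open import Data.List.Base using (List; []; _∷_; _++_; concat; head; last; replicate)
open import Data.List.Properties using (++-assoc; ++-cancelˡ; ∷-injectiveˡ)
open import Data.List.Relation.Unary.All using (All; []; _∷_)
open import Data.List.Relation.Unary.Linked using (Linked; []; [-]; _∷_)
open import Data.Maybe.Base using (just)
open import Data.Nat.Base using (ℕ; zero; suc; _*_; _∸_; _≤_; _<_; NonZero; s≤s)
open import Data.Nat.Divisibility using (_∣_)
open import Data.Nat.Properties using (n∸n≡0)
open import Data.Product using (Σ; ∃; ∃!; _×_; _,_; proj₁; proj₂)
open import Data.Sum using (_⊎_; inj₁; inj₂; swap)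
open import Data.Vec.Base using (Vec; lookup; toList)
open import Function.Base using (_on_; _∘_)
open import Function.Bundles using (Inverse; _⇔_)
open import Level using (0ℓ)
open import Relation.Binary.Bundles using (Setoid)
open import Relation.Binary.Core using (Rel)
open import Relation.Binary.Definitions using (Irreflexive; Symmetric; _Respects_; _Respects₂_)
open import Relation.Binary.PropositionalEquality using (_≡_; _≢_; refl; sym; trans; setoid)
import Relation.Binary.Construct.On as On
open import Relation.Nullary.Negation using (¬_)
open import Relation.Unary using (Pred)

-- Vertices form a setoid so that elements of a subset {x | P x}, represented
-- as pairs, can be compared by their first component alone.
record Graph : Set₁ where
  field
    vertices   : Setoid 0ℓ 0ℓ
  open Setoid vertices public using (_≈_) renaming (Carrier to Vertex)
  field
    Adj        : Rel Vertex 0ℓ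
    Adj-sym    : Symmetric Adj
    Adj-irrefl : Irreflexive _≈_ Adj
    Adj-resp   : Adj Respects₂ _≈_

record _≅_ (G H : Graph) : Set where
  private
    module G = Graph G
    module H = Graph H
  field
    bijection : Inverse G.vertices H.vertices
  open Inverse bijection public using (to; from)
  field
    adjacency : ∀ x y → G.Adj x y ⇔ H.Adj (to x) (to y)

infix 4 _≅_

subsetoid : (S : Setoid 0ℓ 0ℓ) → Pred (Setoid.Carrier S) 0ℓ → Setoid 0ℓ 0ℓ
subsetoid S P = On.setoid {B = Σ (Setoid.Carrier S) P} S proj₁

record Subgraph (G : Graph) : Set₁ where
  open Graph G
  field
    InV      : Pred Vertex 0ℓ
    InE      : Rel Vertex 0ℓ
    InV-resp : InV Respects _≈_
    InE-resp : InE Respects₂ _≈_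
    InE-sym  : Symmetric InE
    InE⇒Adj  : ∀ {x y} → InE x y → Adj x y
    InE⇒InV  : ∀ {x y} → InE x y → InV x × InV y

asGraph : {G : Graph} → Subgraph G → Graph
asGraph {G} H = record
  { vertices   = subsetoid vertices InV
  ; Adj        = InE on proj₁
  ; Adj-sym    = InE-sym
  ; Adj-irrefl = λ x≈y e → Adj-irrefl x≈y (InE⇒Adj e)
  ; Adj-resp   = (λ eq → proj₁ InE-resp eq) , (λ eq → proj₂ InE-resp eq)
  }
  where
  open Graph G
  open Subgraph H

induced : (G : Graph) (P : Pred (Graph.Vertex G) 0ℓ) → P Respects (Graph._≈_ G) → Subgraph G
induced G P P-resp = record
  { InV      = P
  ; InE      = λ x y → P x × P y × Adj x y
  ; InV-resp = P-resp
  ; InE-resp = (λ eq (px , py , a) → px , P-resp eq py , proj₁ Adj-resp eq a)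
             , (λ eq (px , py , a) → P-resp eq px , py , proj₂ Adj-resp eq a)
  ; InE-sym  = λ (px , py , a) → py , px , Adj-sym a
  ; InE⇒Adj  = λ (_ , _ , a) → a
  ; InE⇒InV  = λ (px , py , _) → px , py
  }
  where open Graph G

Letter : ℕ → Set
Letter k = Fin (suc k)

-- A factorization w = u kᵐ v is a maximal run of k when u does not end with k
-- and v does not start with k; the degenerate case m = 0 imposes nothing.
IsPell : ∀ {n} k → Vec (Letter k) n → Set
IsPell k w = ∀ u m v → toList w ≡ u ++ replicate m (fromℕ k) ++ v →
             last u ≢ just (fromℕ k) → head v ≢ just (fromℕ k) → 2 ∣ m

data Replace (k : ℕ) (x y : List (Letter k)) : Set where
  0→i   : ∀ u v i → 1 ≤ toℕ i → toℕ i < k →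
          x ≡ u ++ zero ∷ v → y ≡ u ++ i ∷ v → Replace k x y
  00→kk : ∀ u v →
          x ≡ u ++ zero ∷ zero ∷ v → y ≡ u ++ fromℕ k ∷ fromℕ k ∷ v → Replace k x y

Replace-irrefl : ∀ {k} .{{_ : NonZero k}} {x} → ¬ Replace k x x
Replace-irrefl (0→i u v i 1≤i _ p q)
  with refl ← ∷-injectiveˡ (++-cancelˡ u _ _ (trans (sym p) q)) with () ← 1≤i
Replace-irrefl {suc k} (00→kk u v p q)
  with () ← ∷-injectiveˡ (++-cancelˡ u _ _ (trans (sym p) q))

-- For k = 0 the replacement 00 → kk would create loops.
MunariniGraph : (n k : ℕ) .{{_ : NonZero k}} → Graph
MunariniGraph n k = record
  { vertices   = subsetoid (setoid (Vec (Letter k) n)) (IsPell k)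
  ; Adj        = adj on proj₁
  ; Adj-sym    = swap
  ; Adj-irrefl = λ { refl (inj₁ r) → Replace-irrefl r ; refl (inj₂ r) → Replace-irrefl r }
  ; Adj-resp   = (λ { refl a → a }) , (λ { refl a → a })
  }
  where
  adj : Rel (Vec (Letter k) n) 0ℓ
  adj x y = Replace k (toList x) (toList y) ⊎ Replace k (toList y) (toList x)

Hypercube : ℕ → Graph
Hypercube m = record
  { vertices   = setoid (Vec Bit m)
  ; Adj        = λ x y → ∃! _≡_ λ i → lookup x i ≢ lookup y i
  ; Adj-sym    = λ (i , i≢ , uniq) → i , i≢ ∘ sym , λ j≢ → uniq (j≢ ∘ sym)
  ; Adj-irrefl = λ { refl (_ , i≢ , _) → i≢ refl }
  ; Adj-resp   = (λ { refl a → a }) , (λ { refl a → a })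
  }

No11 : List Bit → Set
No11 = Linked (λ a b → ¬ (a ≡ 1b × b ≡ 1b))

FibonacciCube : ℕ → Graph
FibonacciCube m = asGraph (induced (Hypercube m) (No11 ∘ toList) (λ { refl p → p }))

A : ℕ → ℕ → List Bit
A k zero    = replicate k 0b
A k (suc j) = replicate j 0b ++ 1b ∷ replicate (k ∸ suc j) 0b

data Block (k : ℕ) : List Bit → Set where
  short : ∀ i → i < k → Block k (A k i)
  long  : Block k (A k k ++ A k 0)

IsMunarini : ℕ → List Bit → Set
IsMunarini k w = ∃ λ bs → All (Block k) bs × w ≡ concat bs

No11-0∷ : ∀ {w} → No11 w → No11 (0b ∷ w)
No11-0∷ {[]}    _ = [-]
No11-0∷ {_ ∷ _} p = (λ { (() , _) }) ∷ p

No11-0ᵐ++ : ∀ m {w} → No11 w → No11 (replicate m 0b ++ w)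
No11-0ᵐ++ zero    p = p
No11-0ᵐ++ (suc m) p = No11-0∷ (No11-0ᵐ++ m p)

No11-10∷ : ∀ {w} → No11 (0b ∷ w) → No11 (1b ∷ 0b ∷ w)
No11-10∷ p = (λ { (_ , ()) }) ∷ p

No11-block++ : ∀ {k} .{{_ : NonZero k}} {b w} → Block k b → No11 w → No11 (b ++ w)
No11-block++ {k} (short zero _) p = No11-0ᵐ++ k p
No11-block++ {suc k} {w = w} (short (suc j) (s≤s j<k)) p
  rewrite ++-assoc (replicate j 0b) (1b ∷ replicate (k ∸ j) 0b) w =
  No11-0ᵐ++ j (one j<k)
  where
  one : ∀ {j k} → suc j ≤ k → No11 (1b ∷ replicate (k ∸ j) 0b ++ w)
  one {zero}  {suc k} _       = No11-10∷ (No11-0ᵐ++ (suc k) p)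
  one {suc j} {suc k} (s≤s q) = one q
No11-block++ {suc k} {w = w} long p
  rewrite n∸n≡0 k
        | ++-assoc (replicate k 0b) (1b ∷ []) (replicate (suc k) 0b)
        | ++-assoc (replicate k 0b) (1b ∷ replicate (suc k) 0b) w =
  No11-0ᵐ++ k (No11-10∷ (No11-0ᵐ++ (suc k) p))

-- Munarini strings are Fibonacci strings, so the vertices of MunariniCube n k
-- are all the Munarini strings of length kn.
IsMunarini⇒No11 : ∀ {k} .{{_ : NonZero k}} {w} → IsMunarini k w → No11 w
IsMunarini⇒No11 {k} (bs , all , refl) = go all
  where
  go : ∀ {bs} → All (Block k) bs → No11 (concat bs)
  go []       = []
  go (b ∷ bs) = No11-block++ b (go bs)

-- The graph Γ⋆ₙ,ₖ.
MunariniCube : (n k : ℕ) → Graph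
MunariniCube n k =
  asGraph (induced (FibonacciCube (k * n)) (IsMunarini k ∘ toList ∘ proj₁) (λ { refl p → p }))

-- A Pell string factors uniquely into letters i < k and pairs kk, and a Munarini string
-- factors uniquely into blocks Aᵢ (i < k) and AₖA₀; both are thus encodings of the same
-- factorizations. On factorizations the moves are 0 → i and 00 → kk. Under the second
-- encoding they change exactly one bit, and conversely two blocks Aᵢ, Aⱼ differ in one bit
-- only if exactly one of i, j is 0; if a block A₀ turns into the first half of AₖA₀, then
-- the next block, being unchanged, is an A₀ on both sides. Every nonempty Munarini string
-- ends in 0, so its last bit can be dropped.

{-# OPTIONS --safe #-}
module Submission where

open import Defs
open import Data.Digit using (Bit; 0b; 1b)
open import Data.Fin.Base using (Fin; zero; suc; toℕ; fromℕ; fromℕ<; inject₁)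
open import Data.Fin.Properties using (fromℕ≢inject₁; inject₁-injective; suc-injective; _≟_; toℕ-fromℕ; toℕ-fromℕ<; toℕ-inject₁; toℕ-injective; toℕ<n)
open import Data.Fin.Relation.Unary.Top using (view; ‵fromℕ; ‵inject₁)
open import Data.List.Base using (List; []; _∷_; _++_; concat; head; last; length; replicate)
open import Data.List.Properties using (++-assoc; ++-cancelˡ; ++-cancelʳ; ++-identityʳ; length-++; length-replicate; ∷-injectiveˡ; ∷-injectiveʳ)
open import Data.List.Relation.Unary.All using (All; []; _∷_)
open import Data.List.Relation.Unary.Linked using ([]; [-]; _∷_)
open import Data.Maybe.Base using (just)
open import Data.Maybe.Properties using (just-injective)
open import Data.Nat.Base using (ℕ; zero; suc; _+_; _*_; _∸_; _≤_; _<_; z≤n; s≤s; NonZero)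
open import Data.Nat.Divisibility using (_∣_; _∣0; ∣-refl; ∣m+n∣m⇒∣n; ∣m∣n⇒∣m+n; ∣⇒≤)
import Data.Nat.Properties as ℕ
open import Data.Product using (Σ; ∃; _×_; _,_; proj₁; proj₂)
open import Data.Sum using (_⊎_; inj₁; inj₂; [_,_]′) renaming (map to ⊎-map)
open import Data.Vec.Base using (Vec; []; _∷_; lookup; toList; fromList)
open import Data.Vec.Properties using (cast-is-id; length-toList; toList-injective; toList∘fromList)
open import Function.Base using (_∘_)
open import Function.Bundles using (_⇔_; mk⇔)
open import Function.Construct.Composition using (_⇔-∘_)
open import Function.Construct.Symmetry using (⇔-sym)
open import Level using (0ℓ)
open import Relation.Binary.Bundles using (Setoid)
open import Relation.Binary.Core using (Rel)
open import Relation.Binary.Definitions using (Symmetric)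
open import Relation.Binary.PropositionalEquality using (_≡_; _≢_; refl; sym; trans; cong; cong₂; subst; subst₂)
open import Relation.Nullary.Decidable using (decidable-stable)
open import Relation.Nullary.Negation using (¬_; contradiction)
open import Relation.Unary using (Pred)

-- Graphs presented by a relation on an index type.

record Parametrization {I : Set} (R : Rel I 0ℓ) (G : Graph) : Set where
  open Graph G
  field
    vertex       : I → Vertex
    index        : Vertex → I
    vertex-index : ∀ x → vertex (index x) ≈ x
    injective    : ∀ i j → vertex i ≈ vertex j → i ≡ j
    adjacent     : ∀ i j → Adj (vertex i) (vertex j) ⇔ R i j

  -- In the uses below a vertex is a string paired with proofs, and its index is computed from a
  -- proof as well as from the string. Injectivity of `vertex` makes the result independent of the
  -- proof.
  index-cong : ∀ {x y} → x ≈ y → index x ≡ index y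
  index-cong {x} {y} x≈y =
    injective _ _ (≈-trans (vertex-index x) (≈-trans x≈y (≈-sym (vertex-index y))))
    where open Setoid vertices using () renaming (trans to ≈-trans; sym to ≈-sym)

  index-vertex : ∀ i → index (vertex i) ≡ i
  index-vertex i = injective _ _ (vertex-index (vertex i))

  adjacent-index : ∀ x y → Adj x y ⇔ R (index x) (index y)
  adjacent-index x y = adjacent (index x) (index y) ⇔-∘ mk⇔
    (λ a → resp (≈-sym (vertex-index x)) (≈-sym (vertex-index y)) a)
    (λ a → resp (vertex-index x) (vertex-index y) a)
    where
    open Setoid vertices using () renaming (sym to ≈-sym)
    resp : ∀ {x x′ y y′} → x ≈ x′ → y ≈ y′ → Adj x y → Adj x′ y′
    resp p q a = proj₂ Adj-resp p (proj₁ Adj-resp q a)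

module _ {I : Set} {R : Rel I 0ℓ} {G H : Graph}
         (P : Parametrization R G) (Q : Parametrization R H) where
  private
    module G = Graph G
    module H = Graph H
    module P = Parametrization P
    module Q = Parametrization Q
    module GS = Setoid G.vertices
    module HS = Setoid H.vertices

  -- Both directions pass through the common index type, so the two encodings never have to be
  -- translated into each other directly.
  parametrizations⇒≅ : G ≅ H
  parametrizations⇒≅ = record
    { bijection = record
      { to        = Q.vertex ∘ P.index
      ; from      = P.vertex ∘ Q.index
      ; to-cong   = λ x≈y → HS.reflexive (cong Q.vertex (P.index-cong x≈y))
      ; from-cong = λ x≈y → GS.reflexive (cong P.vertex (Q.index-cong x≈y))
      ; inverse   =
          (λ {x} {y} y≈ → HS.trans
            (HS.reflexive (cong Q.vertex (trans (P.index-cong y≈) (P.index-vertex (Q.index x)))))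
            (Q.vertex-index x))
        , (λ {x} {y} y≈ → GS.trans
            (GS.reflexive (cong P.vertex (trans (Q.index-cong y≈) (Q.index-vertex (P.index x)))))
            (P.vertex-index x))
      }
    ; adjacency = λ x y → ⇔-sym (Q.adjacent (P.index x) (P.index y)) ⇔-∘ P.adjacent-index x y
    }

-- Factorizations and the moves between them.

data Parse (k : ℕ) : ℕ → Set where
  ε      : Parse k 0
  letter : ∀ {n} → Fin k → Parse k n → Parse k (suc n)
  double : ∀ {n} → Parse k n → Parse k (suc (suc n))

-- Directed away from zeros; `Moves` symmetrizes. Since the top letter is positive here, every 0 of
-- a Pell string is a factor of its own, so a substring 00 always appears as two consecutive
-- `letter zero`.
data Step {k : ℕ} : ∀ {n} → Rel (Parse (suc k) n) 0ℓ where
  0→i    : ∀ {n} i (p : Parse _ n) → Step (letter zero p) (letter (suc i) p)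
  00→kk  : ∀ {n} (p : Parse _ n) → Step (letter zero (letter zero p)) (double p)
  letter : ∀ {n} i {p q : Parse _ n} → Step p q → Step (letter i p) (letter i q)
  double : ∀ {n} {p q : Parse _ n} → Step p q → Step (double p) (double q)

Moves : ∀ {k n} → Rel (Parse (suc k) n) 0ℓ
Moves p q = Step p q ⊎ Step q p

toList-injective′ : ∀ {A : Set} {n} (xs ys : Vec A n) → toList xs ≡ toList ys → xs ≡ ys
toList-injective′ xs ys eq = trans (sym (cast-is-id refl xs)) (toList-injective refl xs ys eq)

-- Pell strings

word : ∀ {k n} → Parse k n → Vec (Letter k) n
word ε            = []
word (letter i p) = inject₁ i ∷ word p
word (double p)   = fromℕ _ ∷ fromℕ _ ∷ word p

spell : ∀ {k n} → Parse k n → List (Letter k)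
spell = toList ∘ word

inject₁≢fromℕ : ∀ {n} {i : Fin n} → inject₁ i ≢ fromℕ n
inject₁≢fromℕ = fromℕ≢inject₁ ∘ sym

-- The first character tells the first factor: it is the top letter exactly for a pair.
spell-injective : ∀ {k n} (p q : Parse k n) → spell p ≡ spell q → p ≡ q
spell-injective ε ε _ = refl
spell-injective (letter i p) (letter j q) eq =
  cong₂ letter (inject₁-injective (∷-injectiveˡ eq)) (spell-injective p q (∷-injectiveʳ eq))
spell-injective (letter i p) (double q) eq = contradiction (∷-injectiveˡ eq) inject₁≢fromℕ
spell-injective (double p) (letter j q) eq = contradiction (∷-injectiveˡ eq) fromℕ≢inject₁
spell-injective (double p) (double q) eq =
  cong double (spell-injective p q (∷-injectiveʳ (∷-injectiveʳ eq)))

last-tail : ∀ {A : Set} {x y : A} u → last (x ∷ u) ≢ just y → last u ≢ just y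
last-tail []      _ ()
last-tail (_ ∷ _) h = h

last-∷ : ∀ {A : Set} {x y : A} u → x ≢ y → last u ≢ just y → last (x ∷ u) ≢ just y
last-∷ []      x≢y _ = x≢y ∘ just-injective
last-∷ (_ ∷ _) _   h = h

-- Factors are stripped from the front. A maximal run cannot begin or end in the middle of a pair
-- `kk`, so it loses two characters at a time.
word-isPell : ∀ {k n} (p : Parse k n) → IsPell k (word p)
word-isPell p u zero v _ _ _ = 2 ∣0
word-isPell ε [] (suc m) v () _ _
word-isPell ε (_ ∷ _) (suc m) v () _ _
word-isPell (letter i p) [] (suc m) v eq _ _ = contradiction (∷-injectiveˡ eq) inject₁≢fromℕ
word-isPell (letter i p) (_ ∷ u) m@(suc _) v eq hu hv =
  word-isPell p u m v (∷-injectiveʳ eq) (last-tail u hu) hv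
-- A run of length 1 here would be followed by the second half of the pair.
word-isPell (double p) [] 1 v eq _ hv =
  contradiction (cong head (sym (∷-injectiveʳ eq))) hv
word-isPell (double p) [] (suc (suc m)) v eq hu hv =
  ∣m∣n⇒∣m+n ∣-refl (word-isPell p [] m v (∷-injectiveʳ (∷-injectiveʳ eq)) (λ ()) hv)
-- The run would start at the second half of the pair, but then `u` ends with the top letter.
word-isPell (double p) (_ ∷ []) (suc m) v eq hu _ =
  contradiction (cong just (sym (∷-injectiveˡ eq))) hu
word-isPell (double p) (_ ∷ y ∷ u) m@(suc _) v eq hu hv =
  word-isPell p u m v (∷-injectiveʳ (∷-injectiveʳ eq)) (last-tail u hu) hv

2∤1 : ¬ 2 ∣ 1
2∤1 d with ∣⇒≤ d
... | s≤s ()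

-- Greedy parsing from the left: an initial top letter must be followed by another one, as otherwise
-- it would be a maximal run of length 1.
parseWord : ∀ {k n} (w : Vec (Letter k) n) → IsPell k w → ∃ λ p → word p ≡ w
parseWord [] _ = ε , refl
parseWord {k} (x ∷ w) pell with view x
... | ‵inject₁ i = letter i (proj₁ rec) , cong (inject₁ i ∷_) (proj₂ rec)
  where
  rec = parseWord w λ u m v eq hu hv →
    pell (inject₁ i ∷ u) m v (cong (inject₁ i ∷_) eq) (last-∷ u inject₁≢fromℕ hu) hv
parseWord (x ∷ []) pell | ‵fromℕ = contradiction (pell [] 1 [] refl (λ ()) (λ ())) 2∤1
parseWord {k} (x ∷ y ∷ w) pell | ‵fromℕ with view y
... | ‵inject₁ i =
  contradiction (pell [] 1 (inject₁ i ∷ toList w) refl (λ ()) (inject₁≢fromℕ ∘ just-injective)) 2∤1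
... | ‵fromℕ = double (proj₁ rec) , cong (λ w → fromℕ k ∷ fromℕ k ∷ w) (proj₂ rec)
  where
  isPell : IsPell k w
  -- A run at the very start of `w` merges with the removed pair into a run of length `m + 2`; any
  -- other run is merely shifted.
  isPell [] m v eq hu hv =
    ∣m+n∣m⇒∣n (pell [] (suc (suc m)) v (cong (λ w → fromℕ k ∷ fromℕ k ∷ w) eq) hu hv) ∣-refl
  isPell u@(_ ∷ _) m v eq hu hv =
    pell (fromℕ k ∷ fromℕ k ∷ u) m v (cong (λ w → fromℕ k ∷ fromℕ k ∷ w) eq) hu hv
  rec = parseWord w isPell

Replace-∷ : ∀ {k x y} a → Replace k x y → Replace k (a ∷ x) (a ∷ y)
Replace-∷ a (0→i u v i 1≤i i<k p q) = 0→i (a ∷ u) v i 1≤i i<k (cong (a ∷_) p) (cong (a ∷_) q)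
Replace-∷ a (00→kk u v p q)         = 00→kk (a ∷ u) v (cong (a ∷_) p) (cong (a ∷_) q)

Step⇒Replace : ∀ {k n} {p q : Parse (suc k) n} → Step p q → Replace (suc k) (spell p) (spell q)
Step⇒Replace {k} (0→i i p) =
  0→i [] _ (inject₁ (suc i)) (s≤s z≤n)
    (subst (_< suc k) (sym (toℕ-inject₁ (suc i))) (toℕ<n (suc i))) refl refl
Step⇒Replace (00→kk p)    = 00→kk [] _ refl refl
Step⇒Replace (letter i s) = Replace-∷ _ (Step⇒Replace s)
Step⇒Replace (double s)   = Replace-∷ _ (Replace-∷ _ (Step⇒Replace s))

-- Both parses are followed along the common prefix `u`, where equal characters force equal factors.
-- At the replacement, the remainders have the same spelling and hence the same parse.
Replace⇒Step : ∀ {k n} (p q : Parse (suc k) n) → Replace (suc k) (spell p) (spell q) → Step p q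
Replace⇒Step p q (0→i u v i 1≤i i<k eqp eqq) = go u p q eqp eqq
  where
  go : ∀ {n} u (p q : Parse _ n) → spell p ≡ u ++ zero ∷ v → spell q ≡ u ++ i ∷ v → Step p q
  go [] ε _ () _
  go [] (double p) _ () _
  go [] (letter (suc _) p) _ () _
  go [] (letter zero p) (letter zero q) eqp eqq with refl ← ∷-injectiveˡ eqq = contradiction 1≤i λ ()
  go [] (letter zero p) (letter (suc j) q) eqp eqq
    with refl ← spell-injective p q (trans (∷-injectiveʳ eqp) (sym (∷-injectiveʳ eqq))) = 0→i j p
  -- Here `i` would be the top letter, against `i<k`.
  go [] (letter zero p) (double q) eqp eqq with refl ← ∷-injectiveˡ eqq =
    contradiction i<k (ℕ.≤⇒≯ (ℕ.≤-reflexive (sym (toℕ-fromℕ _))))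
  go (x ∷ u) (letter i p) (letter j q) eqp eqq
    with refl ← inject₁-injective (trans (∷-injectiveˡ eqp) (sym (∷-injectiveˡ eqq))) =
    letter i (go u p q (∷-injectiveʳ eqp) (∷-injectiveʳ eqq))
  go (x ∷ u) (letter i p) (double q) eqp eqq =
    contradiction (trans (∷-injectiveˡ eqp) (sym (∷-injectiveˡ eqq))) inject₁≢fromℕ
  go (x ∷ u) (double p) (letter i q) eqp eqq =
    contradiction (trans (∷-injectiveˡ eqp) (sym (∷-injectiveˡ eqq))) fromℕ≢inject₁
  -- The replaced 0 would be the second half of a pair.
  go (x ∷ []) (double p) (double q) () eqq
  go (x ∷ y ∷ u) (double p) (double q) eqp eqq =
    double (go u p q (∷-injectiveʳ (∷-injectiveʳ eqp)) (∷-injectiveʳ (∷-injectiveʳ eqq)))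
Replace⇒Step p q (00→kk u v eqp eqq) = go u p q eqp eqq
  where
  go : ∀ {n} u (p q : Parse _ n) → spell p ≡ u ++ zero ∷ zero ∷ v →
       spell q ≡ u ++ fromℕ _ ∷ fromℕ _ ∷ v → Step p q
  go [] _ (letter j q) _ eqq = contradiction (∷-injectiveˡ eqq) inject₁≢fromℕ
  go [] (letter zero (letter zero p)) (double q) eqp eqq
    with refl ← spell-injective p q
      (trans (∷-injectiveʳ (∷-injectiveʳ eqp)) (sym (∷-injectiveʳ (∷-injectiveʳ eqq)))) = 00→kk p
  go [] (letter zero (letter (suc _) p)) (double q) () eqq
  go [] (letter zero (double p)) (double q) () eqq
  go [] (letter (suc _) p) (double q) () eqq
  go [] (double p) (double q) () eqq
  go (x ∷ u) (letter i p) (letter j q) eqp eqq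
    with refl ← inject₁-injective (trans (∷-injectiveˡ eqp) (sym (∷-injectiveˡ eqq))) =
    letter i (go u p q (∷-injectiveʳ eqp) (∷-injectiveʳ eqq))
  go (x ∷ u) (letter i p) (double q) eqp eqq =
    contradiction (trans (∷-injectiveˡ eqp) (sym (∷-injectiveˡ eqq))) inject₁≢fromℕ
  go (x ∷ u) (double p) (letter i q) eqp eqq =
    contradiction (trans (∷-injectiveˡ eqp) (sym (∷-injectiveˡ eqq))) fromℕ≢inject₁
  go (x ∷ []) (double p) (double q) () eqq
  go (x ∷ y ∷ u) (double p) (double q) eqp eqq =
    double (go u p q (∷-injectiveʳ (∷-injectiveʳ eqp)) (∷-injectiveʳ (∷-injectiveʳ eqq)))

pellParametrization : ∀ k n → Parametrization (Moves {k} {n}) (MunariniGraph n (suc k))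
pellParametrization k n = record
  { vertex       = λ p → word p , word-isPell p
  ; index        = λ (w , pell) → proj₁ (parseWord w pell)
  ; vertex-index = λ (w , pell) → proj₂ (parseWord w pell)
  ; injective    = λ p q eq → spell-injective p q (cong toList eq)
  ; adjacent     = λ p q → mk⇔ (⊎-map (Replace⇒Step p q) (Replace⇒Step q p))
                               (⊎-map Step⇒Replace Step⇒Replace)
  }

-- Strings differing in one bit

-- Hypercube adjacency in inductive form on lists, which can be cut and glued along `++` without
-- tracking coordinates.
data Flip : Rel (List Bit) 0ℓ where
  here  : ∀ {a b xs} → a ≢ b → Flip (a ∷ xs) (b ∷ xs)
  there : ∀ {a xs ys} → Flip xs ys → Flip (a ∷ xs) (a ∷ ys)

Flip-sym : Symmetric Flip
Flip-sym (here a≢b) = here (a≢b ∘ sym)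
Flip-sym (there f)  = there (Flip-sym f)

Flip-++ʳ : ∀ {xs ys} zs → Flip xs ys → Flip (xs ++ zs) (ys ++ zs)
Flip-++ʳ zs (here a≢b) = here a≢b
Flip-++ʳ zs (there f)  = there (Flip-++ʳ zs f)

Flip-++ˡ : ∀ xs {ys zs} → Flip ys zs → Flip (xs ++ ys) (xs ++ zs)
Flip-++ˡ []       f = f
Flip-++ˡ (_ ∷ xs) f = there (Flip-++ˡ xs f)

-- Equality of the tails is propositional because they are often concatenations, on which direct
-- matching with `here` would get stuck.
Flip-∷⁻ : ∀ {a b xs ys} → Flip (a ∷ xs) (b ∷ ys) → (a ≢ b × xs ≡ ys) ⊎ (a ≡ b × Flip xs ys)
Flip-∷⁻ (here a≢b) = inj₁ (a≢b , refl)
Flip-∷⁻ (there f)  = inj₂ (refl , f)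

Flip-cancelˡ : ∀ xs {ys zs} → Flip (xs ++ ys) (xs ++ zs) → Flip ys zs
Flip-cancelˡ []       f = f
Flip-cancelˡ (_ ∷ xs) f with Flip-∷⁻ f
... | inj₁ (x≢x , _) = contradiction refl x≢x
... | inj₂ (_ , g)   = Flip-cancelˡ xs g

++-injective : ∀ {A : Set} (xs ys : List A) {us vs} → length xs ≡ length ys →
               xs ++ us ≡ ys ++ vs → xs ≡ ys × us ≡ vs
++-injective []       []       _   eq = refl , eq
++-injective (x ∷ xs) (y ∷ ys) len eq with ++-injective xs ys (ℕ.suc-injective len) (∷-injectiveʳ eq)
... | eq₁ , eq₂ = cong₂ _∷_ (∷-injectiveˡ eq) eq₁ , eq₂

-- Equal lengths put the cut at the same position in both strings, so the changed bit lies on one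
-- side of it.
Flip-++⁻ : ∀ xs ys {us vs} → length xs ≡ length ys → Flip (xs ++ us) (ys ++ vs) →
           (Flip xs ys × us ≡ vs) ⊎ (xs ≡ ys × Flip us vs)
Flip-++⁻ [] [] _ f = inj₂ (refl , f)
Flip-++⁻ (x ∷ xs) (y ∷ ys) len f with Flip-∷⁻ f
... | inj₁ (x≢y , eq) with refl , eq′ ← ++-injective xs ys (ℕ.suc-injective len) eq =
  inj₁ (here x≢y , eq′)
... | inj₂ (refl , g) with Flip-++⁻ xs ys (ℕ.suc-injective len) g
...   | inj₁ (h , eq)   = inj₁ (there h , eq)
...   | inj₂ (refl , h) = inj₂ (refl , h)

Flip⇒hypercube : ∀ {m} (x y : Vec Bit m) → Flip (toList x) (toList y) → Graph.Adj (Hypercube m) x y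
Flip⇒hypercube [] [] ()
Flip⇒hypercube (a ∷ x) (b ∷ y) f with Flip-∷⁻ f
... | inj₁ (a≢b , eq) with refl ← toList-injective′ x y eq =
  zero , a≢b , λ { {zero} _ → refl ; {suc j} j≢ → contradiction refl j≢ }
... | inj₂ (refl , g) with i , i≢ , unique ← Flip⇒hypercube x y g =
  suc i , i≢ , λ { {zero} 0≢ → contradiction refl 0≢ ; {suc j} j≢ → cong suc (unique j≢) }

agree⇒≡ : ∀ {m} (x y : Vec Bit m) → (∀ i → lookup x i ≡ lookup y i) → x ≡ y
agree⇒≡ []      []      _ = refl
agree⇒≡ (_ ∷ x) (_ ∷ y) h = cong₂ _∷_ (h zero) (agree⇒≡ x y (h ∘ suc))

hypercube⇒Flip : ∀ {m} (x y : Vec Bit m) → Graph.Adj (Hypercube m) x y → Flip (toList x) (toList y)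
hypercube⇒Flip (a ∷ x) (b ∷ y) (zero , a≢b , unique)
  -- A second differing coordinate would equal `zero` by uniqueness; decidable equality of bits
  -- turns this refutation into agreement.
  with refl ← agree⇒≡ x y (λ j → decidable-stable (lookup x j ≟ lookup y j)
                                   λ j≢ → contradiction (unique {suc j} j≢) λ ()) = here a≢b
hypercube⇒Flip (a ∷ x) (b ∷ y) (suc i , i≢ , unique)
  with refl ← decidable-stable (a ≟ b) (λ a≢b → contradiction (unique {zero} a≢b) λ ()) =
  there (hypercube⇒Flip x y (i , i≢ , λ j≢ → suc-injective (unique j≢)))

-- Subgraphs of the Fibonacci cube induced by the image of a code.

toVec : ∀ {A : Set} {m} (xs : List A) → length xs ≡ m → Σ (Vec A m) λ v → toList v ≡ xs
toVec xs refl = fromList xs , toList∘fromList xs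

fibonacciStrings : ∀ m → Pred (List Bit) 0ℓ → Subgraph (FibonacciCube m)
fibonacciStrings m Q = induced (FibonacciCube m) (Q ∘ toList ∘ proj₁) λ { refl q → q }

-- `Q` describes the image of `code` among strings of length `m`. The instances are `bits` and its
-- truncation `trim`.
module _ {I : Set} {R : Rel I 0ℓ} (m : ℕ) (Q : Pred (List Bit) 0ℓ) (code : I → List Bit)
         (code-length : ∀ i → length (code i) ≡ m)
         (code-Q : ∀ i → Q (code i))
         (code-No11 : ∀ i → No11 (code i))
         (code-injective : ∀ i j → code i ≡ code j → i ≡ j)
         (decode : ∀ xs → length xs ≡ m → Q xs → ∃ λ i → code i ≡ xs)
         (code-Flip : ∀ i j → Flip (code i) (code j) ⇔ R i j) where

  private
    codeVec : I → Vec Bit m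
    codeVec i = proj₁ (toVec (code i) (code-length i))

    toList-codeVec : ∀ i → toList (codeVec i) ≡ code i
    toList-codeVec i = proj₂ (toVec (code i) (code-length i))

    decodeVec : (x : Vec Bit m) → Q (toList x) → ∃ λ i → code i ≡ toList x
    decodeVec x = decode (toList x) (length-toList x)

    codeVec-No11 : ∀ i → No11 (toList (codeVec i))
    codeVec-No11 i = subst No11 (sym (toList-codeVec i)) (code-No11 i)

    codeVec-Q : ∀ i → Q (toList (codeVec i))
    codeVec-Q i = subst Q (sym (toList-codeVec i)) (code-Q i)

  codeParametrization : Parametrization R (asGraph (fibonacciStrings m Q))
  codeParametrization = record
    { vertex       = λ i → (codeVec i , codeVec-No11 i) , codeVec-Q i
    ; index        = λ ((x , _) , q) → proj₁ (decodeVec x q)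
    ; vertex-index = λ ((x , _) , q) →
        toList-injective′ _ x (trans (toList-codeVec _) (proj₂ (decodeVec x q)))
    ; injective    = λ i j eq → code-injective i j
        (trans (sym (toList-codeVec i)) (trans (cong toList eq) (toList-codeVec j)))
    ; adjacent     = λ i j → code-Flip i j ⇔-∘ mk⇔
        (λ (_ , _ , _ , _ , a) →
          subst₂ Flip (toList-codeVec i) (toList-codeVec j) (hypercube⇒Flip _ _ a))
        (λ f → codeVec-Q i , codeVec-Q j , codeVec-No11 i , codeVec-No11 j ,
          Flip⇒hypercube _ _ (subst₂ Flip (sym (toList-codeVec i)) (sym (toList-codeVec j)) f))
    }

-- Munarini strings

length-A : ∀ k i → i ≤ k → length (A k i) ≡ k
length-A k       zero          _         = length-replicate k
length-A (suc k) 1             _         = cong suc (length-replicate k)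
length-A (suc k) (suc (suc i)) (s≤s i<k) = cong suc (length-A k (suc i) i<k)

0ᵐ≢0ⁿ1 : ∀ m n {v} → replicate m 0b ≢ replicate n 0b ++ 1b ∷ v
0ᵐ≢0ⁿ1 zero    zero    ()
0ᵐ≢0ⁿ1 (suc m) zero    ()
0ᵐ≢0ⁿ1 (suc m) (suc n) eq = 0ᵐ≢0ⁿ1 m n (∷-injectiveʳ eq)

0ᵐ1-injective : ∀ m n {u v} → replicate m 0b ++ 1b ∷ u ≡ replicate n 0b ++ 1b ∷ v → m ≡ n
0ᵐ1-injective zero    zero    _  = refl
0ᵐ1-injective (suc m) (suc n) eq = cong suc (0ᵐ1-injective m n (∷-injectiveʳ eq))

A-injective : ∀ k i j → A k i ≡ A k j → i ≡ j
A-injective k zero    zero    _  = refl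
A-injective k zero    (suc j) eq = contradiction eq (0ᵐ≢0ⁿ1 k j)
A-injective k (suc i) zero    eq = contradiction (sym eq) (0ᵐ≢0ⁿ1 k i)
A-injective k (suc i) (suc j) eq = cong suc (0ᵐ1-injective i j eq)

Flip-A₀-A : ∀ k i → suc i ≤ k → Flip (A k 0) (A k (suc i))
Flip-A₀-A (suc k) zero    _         = here λ ()
Flip-A₀-A (suc k) (suc i) (s≤s i<k) = there (Flip-A₀-A k i i<k)

¬Flip-0ᵐ : ∀ m n → ¬ Flip (replicate m 0b) (replicate n 0b)
¬Flip-0ᵐ (suc m) (suc n) f with Flip-∷⁻ f
... | inj₁ (0≢0 , _) = 0≢0 refl
... | inj₂ (_ , g)   = ¬Flip-0ᵐ m n g

-- If the 1s are at different positions, the strings already differ at the first of them, and only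
-- one remainder still contains a 1. If the positions agree, only zeros remain to be compared.
¬Flip-0ᵐ10ⁿ : ∀ i j m n → ¬ Flip (replicate i 0b ++ 1b ∷ replicate m 0b)
                                 (replicate j 0b ++ 1b ∷ replicate n 0b)
¬Flip-0ᵐ10ⁿ zero zero m n f with Flip-∷⁻ f
... | inj₁ (1≢1 , _) = 1≢1 refl
... | inj₂ (_ , g)   = ¬Flip-0ᵐ m n g
¬Flip-0ᵐ10ⁿ zero (suc j) m n f with Flip-∷⁻ f
... | inj₁ (_ , eq) = 0ᵐ≢0ⁿ1 m j eq
¬Flip-0ᵐ10ⁿ (suc i) zero m n f with Flip-∷⁻ f
... | inj₁ (_ , eq) = 0ᵐ≢0ⁿ1 n i (sym eq)
¬Flip-0ᵐ10ⁿ (suc i) (suc j) m n f with Flip-∷⁻ f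
... | inj₁ (0≢0 , _) = 0≢0 refl
... | inj₂ (_ , g)   = ¬Flip-0ᵐ10ⁿ i j m n g

-- The block `AₖA₀` is nested to the right, so that the first `k` bits split off alike for both
-- kinds of factor.
bits : ∀ {k n} → Parse k n → List Bit
bits {k} ε            = []
bits {k} (letter i p) = A k (toℕ i) ++ bits p
bits {k} (double p)   = A k k ++ A k 0 ++ bits p

length-A-letter : ∀ {k} (i : Fin k) → length (A k (toℕ i)) ≡ k
length-A-letter i = length-A _ (toℕ i) (ℕ.<⇒≤ (toℕ<n i))

length-A-letters : ∀ {k} (i j : Fin k) → length (A k (toℕ i)) ≡ length (A k (toℕ j))
length-A-letters i j = trans (length-A-letter i) (sym (length-A-letter j))

length-A-letter-Aₖ : ∀ {k} (i : Fin k) → length (A k (toℕ i)) ≡ length (A k k)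
length-A-letter-Aₖ {k} i = trans (length-A-letter i) (sym (length-A k k ℕ.≤-refl))

length-bits : ∀ {k n} (p : Parse k n) → length (bits p) ≡ n * k
length-bits ε = refl
length-bits {k} (letter i p) =
  trans (length-++ (A k (toℕ i))) (cong₂ _+_ (length-A-letter i) (length-bits p))
length-bits {k} (double p) =
  trans (length-++ (A k k)) (cong₂ _+_ (length-A k k ℕ.≤-refl)
    (trans (length-++ (A k 0)) (cong₂ _+_ (length-replicate k) (length-bits p))))

A-letter≢Aₖ : ∀ {k} (i : Fin k) → A k (toℕ i) ≢ A k k
A-letter≢Aₖ {k} i eq = ℕ.<⇒≢ (toℕ<n i) (A-injective k (toℕ i) k eq)

-- The first `k` bits determine the first factor, since `A₀`, ..., `Aₖ` are distinct and have the
-- same length.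
bits-injective : ∀ {k n} (p q : Parse k n) → bits p ≡ bits q → p ≡ q
bits-injective ε ε _ = refl
bits-injective {k} (letter i p) (letter j q) eq
  with eq₁ , eq₂ ← ++-injective (A k (toℕ i)) (A k (toℕ j)) (length-A-letters i j) eq =
  cong₂ letter (toℕ-injective (A-injective k _ _ eq₁)) (bits-injective p q eq₂)
bits-injective {k} (letter i p) (double q) eq =
  contradiction (proj₁ (++-injective (A k (toℕ i)) (A k k) (length-A-letter-Aₖ i) eq)) (A-letter≢Aₖ i)
bits-injective {k} (double p) (letter j q) eq =
  contradiction (proj₁ (++-injective (A k (toℕ j)) (A k k) (length-A-letter-Aₖ j) (sym eq))) (A-letter≢Aₖ j)
bits-injective {k} (double p) (double q) eq =
  cong double (bits-injective p q (++-cancelˡ (A k 0) _ _ (++-cancelˡ (A k k) _ _ eq)))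

bits-isMunarini : ∀ {k n} (p : Parse k n) → IsMunarini k (bits p)
bits-isMunarini ε = [] , [] , refl
bits-isMunarini (letter i p) with bs , blocks , eq ← bits-isMunarini p =
  _ , short (toℕ i) (toℕ<n i) ∷ blocks , cong (_ ++_) eq
bits-isMunarini {k} (double p) with bs , blocks , eq ← bits-isMunarini p =
  _ , long ∷ blocks
    , trans (sym (++-assoc (A k k) (A k 0) (bits p))) (cong ((A k k ++ A k 0) ++_) eq)

parseBlocks : ∀ {k bs} → All (Block k) bs → ∃ λ n → Σ (Parse k n) λ p → bits p ≡ concat bs
parseBlocks [] = 0 , ε , refl
parseBlocks {k} (short i i<k ∷ blocks) with n , p , eq ← parseBlocks blocks =
  suc n , letter (fromℕ< i<k) p , cong₂ (λ j → A k j ++_) (toℕ-fromℕ< i<k) eq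
parseBlocks {k} (long ∷ blocks) with n , p , eq ← parseBlocks blocks =
  suc (suc n) , double p
    , trans (sym (++-assoc (A k k) (A k 0) (bits p))) (cong ((A k k ++ A k 0) ++_) eq)

parseBits : ∀ {k n} xs → length xs ≡ suc k * n → IsMunarini (suc k) xs →
            ∃ λ (p : Parse (suc k) n) → bits p ≡ xs
parseBits {k} {n} xs len (bs , blocks , refl) with m , p , eq ← parseBlocks blocks
  -- The blocks yield a parse of some length `m`; comparing total lengths and cancelling `suc k`
  -- gives `m ≡ n`.
  with refl ← ℕ.*-cancelˡ-≡ m n (suc k) (trans (ℕ.*-comm (suc k) m)
                (trans (sym (length-bits p)) (trans (cong length eq) len))) = p , eq

-- Moves as changes of a single bit.

Step⇒Flip : ∀ {k n} {p q : Parse (suc k) n} → Step p q → Flip (bits p) (bits q)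
Step⇒Flip (0→i i p)      = Flip-++ʳ _ (Flip-A₀-A _ (toℕ i) (ℕ.<⇒≤ (toℕ<n (suc i))))
Step⇒Flip {k} (00→kk p)  = Flip-++ʳ _ (Flip-A₀-A (suc k) k ℕ.≤-refl)
Step⇒Flip (letter i s)   = Flip-++ˡ (A _ (toℕ i)) (Step⇒Flip s)
Step⇒Flip {k} (double s) = Flip-++ˡ (A (suc k) (suc k)) (Flip-++ˡ (A (suc k) 0) (Step⇒Flip s))

Flip⇒Step-double : ∀ {k n} (i : Fin (suc k)) (p : Parse (suc k) (suc n)) q →
                   Flip (bits (letter i p)) (bits (double q)) → Step (letter i p) (double q)
Flip⇒Step-double {k} i p q f with Flip-++⁻ (A (suc k) (toℕ i)) (A (suc k) (suc k)) (length-A-letter-Aₖ i) f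
... | inj₂ (eq , _) = contradiction eq (A-letter≢Aₖ i)
-- After the changed block, `eq` equates `bits p` with `A₀` followed by `bits q`, which is
-- `bits (letter zero q)`.
Flip⇒Step-double {k} zero p q f | inj₁ (_ , eq)
  with refl ← bits-injective p (letter zero q) eq = 00→kk q
Flip⇒Step-double {k} (suc i) p q f | inj₁ (g , _) =
  contradiction g (¬Flip-0ᵐ10ⁿ (toℕ i) k _ _)

-- The cut after the first `k` bits leaves two cases: the changed bit lies in the first block and
-- the remainders coincide, or the first factors agree and the recursion continues behind them.
Flip⇒Moves : ∀ {k n} (p q : Parse (suc k) n) → Flip (bits p) (bits q) → Moves p q
Flip⇒Moves (letter i p) (letter j q) f
  with Flip-++⁻ (A _ (toℕ i)) (A _ (toℕ j)) (length-A-letters i j) f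
... | inj₂ (eq , g) with refl ← toℕ-injective (A-injective _ (toℕ i) (toℕ j) eq) =
  ⊎-map (letter i) (letter i) (Flip⇒Moves p q g)
... | inj₁ (g , eq) with refl ← bits-injective p q eq = heads i j g
  where
  heads : ∀ i j → Flip (A _ (toℕ i)) (A _ (toℕ j)) → Moves (letter i p) (letter j p)
  heads zero    zero    g = contradiction g (¬Flip-0ᵐ _ _)
  heads zero    (suc j) g = inj₁ (0→i j p)
  heads (suc i) zero    g = inj₂ (0→i i p)
  heads (suc i) (suc j) g = contradiction g (¬Flip-0ᵐ10ⁿ (toℕ i) (toℕ j) _ _)
Flip⇒Moves (letter i p) (double q) f = inj₁ (Flip⇒Step-double i p q f)
Flip⇒Moves (double p) (letter j q) f = inj₂ (Flip⇒Step-double j q p (Flip-sym f))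
Flip⇒Moves {k} (double p) (double q) f = ⊎-map double double
  (Flip⇒Moves p q (Flip-cancelˡ (A (suc k) 0) (Flip-cancelˡ (A (suc k) (suc k)) f)))

Flip⇔Moves : ∀ {k n} (p q : Parse (suc k) n) → Flip (bits p) (bits q) ⇔ Moves p q
Flip⇔Moves p q = mk⇔ (Flip⇒Moves p q) [ Step⇒Flip , Flip-sym ∘ Step⇒Flip ]′

munariniParametrization : ∀ k n → Parametrization (Moves {k} {n}) (MunariniCube n (suc k))
munariniParametrization k n = record { P }
  where
  -- Repackaged because the Adj-resp field of MunariniCube contains an anonymous function.
  module P = Parametrization (codeParametrization (suc k * n) (IsMunarini (suc k)) bits
    (λ p → trans (length-bits p) (ℕ.*-comm n (suc k)))
    bits-isMunarini
    (λ p → IsMunarini⇒No11 (bits-isMunarini p))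
    bits-injective parseBits Flip⇔Moves)

-- Dropping the last bit

EndsIn0 : Pred (List Bit) 0ℓ
EndsIn0 xs = ∃ λ ys → xs ≡ ys ++ 0b ∷ []

EndsIn0-++ : ∀ xs {ys} → EndsIn0 ys → EndsIn0 (xs ++ ys)
EndsIn0-++ xs (ys , refl) = xs ++ ys , sym (++-assoc xs ys _)

A-endsIn0 : ∀ k i → i < k → EndsIn0 (A k i)
A-endsIn0 1             zero          _         = [] , refl
A-endsIn0 (suc (suc k)) zero          _         = EndsIn0-++ (0b ∷ []) (A-endsIn0 (suc k) 0 (s≤s z≤n))
A-endsIn0 (suc (suc k)) 1             _         = EndsIn0-++ (1b ∷ []) (A-endsIn0 (suc k) 0 (s≤s z≤n))
A-endsIn0 (suc k)       (suc (suc i)) (s≤s i<k) = EndsIn0-++ (0b ∷ []) (A-endsIn0 k (suc i) i<k)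

-- The string ends with some `Aᵢ`, `i < k`, or with the `A₀` of a long block. Matching on the tail
-- exposes its positive length for the recursive call.
bits-endsIn0 : ∀ {k n} (p : Parse (suc k) (suc n)) → EndsIn0 (bits p)
bits-endsIn0 {k} (letter i ε) =
  subst EndsIn0 (sym (++-identityʳ _)) (A-endsIn0 (suc k) (toℕ i) (toℕ<n i))
bits-endsIn0 (letter i p@(letter _ _)) = EndsIn0-++ (A _ (toℕ i)) (bits-endsIn0 p)
bits-endsIn0 (letter i p@(double _))   = EndsIn0-++ (A _ (toℕ i)) (bits-endsIn0 p)
bits-endsIn0 {k} (double ε) = EndsIn0-++ (A (suc k) (suc k))
  (subst EndsIn0 (sym (++-identityʳ _)) (A-endsIn0 (suc k) 0 (s≤s z≤n)))
bits-endsIn0 {k} (double p@(letter _ _)) =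
  EndsIn0-++ (A (suc k) (suc k)) (EndsIn0-++ (A (suc k) 0) (bits-endsIn0 p))
bits-endsIn0 {k} (double p@(double _)) =
  EndsIn0-++ (A (suc k) (suc k)) (EndsIn0-++ (A (suc k) 0) (bits-endsIn0 p))

No11-++⁻ˡ : ∀ xs {ys} → No11 (xs ++ ys) → No11 xs
No11-++⁻ˡ []           _       = []
No11-++⁻ˡ (x ∷ [])     _       = [-]
No11-++⁻ˡ (x ∷ y ∷ xs) (r ∷ l) = r ∷ No11-++⁻ˡ (y ∷ xs) l

length-∷ʳ : ∀ (xs : List Bit) → length (xs ++ 0b ∷ []) ≡ suc (length xs)
length-∷ʳ xs = trans (length-++ xs) (ℕ.+-comm (length xs) 1)

trim : ∀ {k n} → Parse (suc k) (suc n) → List Bit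
trim p = proj₁ (bits-endsIn0 p)

bits-trim : ∀ {k n} (p : Parse (suc k) (suc n)) → bits p ≡ trim p ++ 0b ∷ []
bits-trim p = proj₂ (bits-endsIn0 p)

length-trim : ∀ {k n} (p : Parse (suc k) (suc n)) → length (trim p) ≡ suc k * suc n ∸ 1
length-trim {k} {n} p = ℕ.suc-injective (trans (sym (length-∷ʳ (trim p)))
  (trans (cong length (sym (bits-trim p))) (trans (length-bits p) (ℕ.*-comm (suc n) (suc k)))))

trim-Flip : ∀ {k n} (p q : Parse (suc k) (suc n)) → Flip (trim p) (trim q) ⇔ Flip (bits p) (bits q)
trim-Flip p q = mk⇔
  (λ f → subst₂ Flip (sym (bits-trim p)) (sym (bits-trim q)) (Flip-++ʳ _ f))
  (λ f → untrim (Flip-++⁻ (trim p) (trim q) (trans (length-trim p) (sym (length-trim q)))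
                  (subst₂ Flip (bits-trim p) (bits-trim q) f)))
  where
  untrim : (Flip (trim p) (trim q) × 0b ∷ [] ≡ 0b ∷ []) ⊎ (trim p ≡ trim q × Flip (0b ∷ []) (0b ∷ [])) →
           Flip (trim p) (trim q)
  untrim (inj₁ (f , _)) = f
  -- The dropped bit is 0 in both strings, so the change cannot occur there.
  untrim (inj₂ (_ , f)) = contradiction f (¬Flip-0ᵐ 1 1)

-- Describes the image of `trim` without mentioning parses.
PaddedMunarini : ℕ → Pred (List Bit) 0ℓ
PaddedMunarini k xs = IsMunarini k (xs ++ 0b ∷ [])

TrimmedCube : ∀ k n → Subgraph (FibonacciCube (suc k * suc n ∸ 1))
TrimmedCube k n = fibonacciStrings _ (PaddedMunarini (suc k))

trimmedParametrization : ∀ k n → Parametrization (Moves {k} {suc n}) (asGraph (TrimmedCube k n))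
trimmedParametrization k n = codeParametrization _ (PaddedMunarini (suc k)) trim
  length-trim
  (λ p → subst (IsMunarini (suc k)) (bits-trim p) (bits-isMunarini p))
  (λ p → No11-++⁻ˡ (trim p) (subst No11 (bits-trim p) (IsMunarini⇒No11 (bits-isMunarini p))))
  (λ p q eq → bits-injective p q
    (trans (bits-trim p) (trans (cong (_++ 0b ∷ []) eq) (sym (bits-trim q)))))
  untrim
  (λ p q → Flip⇔Moves p q ⇔-∘ trim-Flip p q)
  where
  untrim : ∀ xs → length xs ≡ suc k * suc n ∸ 1 → PaddedMunarini (suc k) xs →
           ∃ λ (p : Parse (suc k) (suc n)) → trim p ≡ xs
  -- The product `suc k * suc n` reduces to a successor, so adding 1 after `∸ 1` restores it
  -- definitionally.
  untrim xs len mun with p , eq ← parseBits _ (trans (length-∷ʳ xs) (cong suc len)) mun =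
    p , ++-cancelʳ _ _ xs (trans (sym (bits-trim p)) eq)

theorem3p1 : (k n : ℕ) .{{_ : NonZero k}} →
    (MunariniGraph n k ≅ MunariniCube n k)
    × (1 ≤ n → Σ (Subgraph (FibonacciCube (k * n ∸ 1))) λ H → MunariniGraph n k ≅ asGraph H)
theorem3p1 (suc k) n =
  parametrizations⇒≅ (pellParametrization k n) (munariniParametrization k n) , trimmed n
  where
  trimmed : ∀ n → 1 ≤ n → Σ (Subgraph (FibonacciCube (suc k * n ∸ 1))) λ H →
            MunariniGraph n (suc k) ≅ asGraph H
  trimmed (suc n) _ = TrimmedCube k n ,
    parametrizations⇒≅ (pellParametrization k (suc n)) (trimmedParametrization k n)
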